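{- Let $a,b$ be positive integers and let $\{F_n(q)\}_{n\geq 0}$ be the $q$-biperiodic Fibonacci sequence. For every $n\geq 0$, $F_{n+1}(q)$ counts the tilings weighted by bicolored squares of an $n$-board; that is, $$F_{n+1}(q)=\sum_{T\in\mathcal{T}_n}a^{|T|_a}b^{|T|_b}q^{|T|}.$$
   Context: Fix positive integers $a,b$; $q$ is an indeterminate. The $q$-biperiodic Fibonacci sequence is defined by $F_0(q)=0$, $F_1(q)=1$ and, for $n\geq 2$, $F_n(q)=aF_{n-1}(q)+q^{n-2}F_{n-2}(q)$ if $n$ is even, $F_n(q)=bF_{n-1}(q)+q^{n-2}F_{n-2}(q)$ if $n$ is odd. An $n$-board is a row of $n$ cells labelled $1,\dots,n$ from left to right; $\mathcal{T}_n$ is the set of all tilings of the $n$-board by squares (covering one cell) and dominoes (covering two consecutive cells $i,i+1$), with $\mathcal T_0$ consisting of the empty tiling. In a tiling weighted by bicolored squares, a square at an odd position can be given any of $a$ colors, a square at an even position any of $b$ colors, and a domino covering cells $i,i+1$ has weight $q^i$. For $T\in\mathcal{T}_n$ (with squares uncolored), $|T|_a$ is the number of squares of $T$ at odd positions, $|T|_b$ is the number of squares of $T$ at even positions, and $|T|$ is the sum of all $i$ such that $T$ has a domino in position $(i,i+1)$. -}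

module Defs where

open import Level using (0ℓ)
open import Algebra.Bundles using (RawSemiring)
import Algebra.Definitions.RawSemiring as RawSemiringDefinitions
open import Data.Nat.Base as ℕ using (ℕ; zero; suc; parity)
open import Data.Parity.Base using (Parity; 0ℙ; 1ℙ)
open import Data.Parity.Properties using (_≟_)
open import Data.List.Base using (List; []; _∷_; _++_; map; foldr; filter; length)
open import Data.Nat.ListAction using (sum)
open import Data.List.Membership.Propositional using (_∈_)
open import Data.List.Membership.Propositional.Properties using (∈-map⁺; ∈-map⁻; ∈-++⁺ˡ; ∈-++⁺ʳ)
open import Data.List.Relation.Unary.Any using (here)
open import Data.List.Relation.Unary.All as All using ()
open import Data.List.Relation.Unary.AllPairs using ([]; _∷_)
open import Data.List.Relation.Unary.Unique.Propositional using (Unique)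
open import Data.List.Relation.Unary.Unique.Propositional.Properties using (map⁺; ++⁺)
open import Data.Empty using (⊥)
open import Data.Product.Base using (∃; _×_; _,_)
open import Relation.Binary.PropositionalEquality using (_≡_; refl)

-- ℕ[q], the subsemiring of ℤ[q] in which everything below lives.  A polynomial
-- is its list of coefficients, constant term first.  Trailing zeros are allowed,
-- so equality of polynomials is _≈_, not _≡_.

Poly : Set
Poly = List ℕ

coeff : Poly → ℕ → ℕ
coeff []      _       = 0
coeff (c ∷ p) zero    = c
coeff (c ∷ p) (suc k) = coeff p k

infix  4 _≈_
infixl 6 _+_
infixl 7 _*_

_≈_ : Poly → Poly → Set
p ≈ r = ∀ k → coeff p k ≡ coeff r k

_+_ : Poly → Poly → Poly
[]      + r       = r
(c ∷ p) + []      = c ∷ p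
(c ∷ p) + (d ∷ r) = (c ℕ.+ d) ∷ (p + r)

_*_ : Poly → Poly → Poly
[]      * r = []
(c ∷ p) * r = map (c ℕ.*_) r + (0 ∷ (p * r))

const : ℕ → Poly
const c = c ∷ []

q : Poly
q = 0 ∷ 1 ∷ []

ℕ[q]-rawSemiring : RawSemiring 0ℓ 0ℓ
ℕ[q]-rawSemiring = record
  { Carrier = Poly
  ; _≈_     = _≈_
  ; _+_     = _+_
  ; _*_     = _*_
  ; 0#      = const 0
  ; 1#      = const 1
  }

open RawSemiring ℕ[q]-rawSemiring public using (0#; 1#)
open RawSemiringDefinitions ℕ[q]-rawSemiring public using (_^_)

infix 5 sumOver
sumOver : {A : Set} → List A → (A → Poly) → Poly
sumOver xs f = foldr _+_ 0# (map f xs)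

syntax sumOver xs (λ x → p) = ∑[ x ← xs ] p

byParity : {A : Set} → Parity → A → A → A
byParity 0ℙ even odd = even
byParity 1ℙ even odd = odd

F : ℕ → ℕ → ℕ → Poly
F a b zero          = 0#
F a b (suc zero)    = 1#
F a b (suc (suc n)) =
  const (byParity (parity (suc (suc n))) a b) * F a b (suc n) + q ^ n * F a b n

-- Tilings are built from left to right: on top of a tiling of the cells 1,…,n,
-- a square covers cell 1+n and a domino covers cells 1+n and 2+n.

data Tiling : ℕ → Set where
  empty    : Tiling 0
  _▸square : ∀ {n} → Tiling n → Tiling (1 ℕ.+ n)
  _▸domino : ∀ {n} → Tiling n → Tiling (2 ℕ.+ n)

squarePositions : ∀ {n} → Tiling n → List ℕ
squarePositions         empty       = []
squarePositions {suc n} (T ▸square) = suc n ∷ squarePositions T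
squarePositions         (T ▸domino) = squarePositions T

-- A domino covering cells i and i+1 is recorded by i.
dominoPositions : ∀ {n} → Tiling n → List ℕ
dominoPositions               empty       = []
dominoPositions               (T ▸square) = dominoPositions T
dominoPositions {suc (suc n)} (T ▸domino) = suc n ∷ dominoPositions T

∣_∣a : ∀ {n} → Tiling n → ℕ
∣ T ∣a = length (filter (λ i → parity i ≟ 1ℙ) (squarePositions T))

∣_∣b : ∀ {n} → Tiling n → ℕ
∣ T ∣b = length (filter (λ i → parity i ≟ 0ℙ) (squarePositions T))

∣_∣ : ∀ {n} → Tiling n → ℕ
∣ T ∣ = sum (dominoPositions T)

-- 𝒯 n lists every tiling of the n-board exactly once, by 𝒯-complete and 𝒯-unique.

𝒯 : ∀ n → List (Tiling n)
𝒯 zero          = empty ∷ []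
𝒯 (suc zero)    = map _▸square (𝒯 zero)
𝒯 (suc (suc n)) = map _▸square (𝒯 (suc n)) ++ map _▸domino (𝒯 n)

𝒯-complete : ∀ {n} (T : Tiling n) → T ∈ 𝒯 n
𝒯-complete               empty       = here refl
𝒯-complete {suc zero}    (T ▸square) = ∈-map⁺ _▸square (𝒯-complete T)
𝒯-complete {suc (suc n)} (T ▸square) = ∈-++⁺ˡ (∈-map⁺ _▸square (𝒯-complete T))
𝒯-complete {suc (suc n)} (T ▸domino) =
  ∈-++⁺ʳ (map _▸square (𝒯 (suc n))) (∈-map⁺ _▸domino (𝒯-complete T))

𝒯-unique : ∀ n → Unique (𝒯 n)
𝒯-unique zero          = All.[] ∷ []
𝒯-unique (suc zero)    = All.[] ∷ []
𝒯-unique (suc (suc n)) =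
  ++⁺ (map⁺ (λ { refl → refl }) (𝒯-unique (suc n)))
      (map⁺ (λ { refl → refl }) (𝒯-unique n))
      λ { (s , d) → disjoint (∈-map⁻ _▸square s) (∈-map⁻ _▸domino d) }
  where
  disjoint : ∀ {T : Tiling (suc (suc n))} →
             ∃ (λ S → S ∈ 𝒯 (suc n) × T ≡ S ▸square) →
             ∃ (λ D → D ∈ 𝒯 n × T ≡ D ▸domino) → ⊥
  disjoint (_ , _ , refl) (_ , _ , ())

{-# OPTIONS --safe #-}
module Submission where

-- Removing the last tile of a tiling of n + 2 cells divides its weight by a or b
-- (a square on cell n + 2) or by q ^ (n + 1) (a domino), so the weight sums obey
-- the recurrence of F.

open import Defs
open import Data.Nat.Base using (ℕ; suc; NonZero)

open import Level using (0ℓ)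
open import Algebra.Bundles using (CommutativeSemiring)
open import Algebra.Structures.Biased
  using (isCommutativeMonoidʳ; isCommutativeSemiringʳ)
import Algebra.Properties.CommutativeSemigroup as CommutativeSemigroupProperties
import Algebra.Properties.Semiring.Exp as SemiringExp
open import Data.List.Base using (List; []; _∷_; _++_; map; foldr)
open import Data.Nat.Base as ℕ using (zero; parity)
import Data.Nat.Properties as ℕ
open import Data.Parity.Base using (0ℙ; 1ℙ)
open import Data.Parity.Properties using (suc-homo-⁻¹)
open import Relation.Binary.Structures using (IsEquivalence)
open import Relation.Binary.PropositionalEquality
  using (_≡_; refl; sym; trans; cong; cong₂; module ≡-Reasoning)

open CommutativeSemigroupProperties ℕ.+-commutativeSemigroup using (x∙yz≈y∙xz; interchange)

-- Classify the tilings of the board with n + 2 cells by their last tile. A square on cell n + 2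
-- contributes a factor a or b according to the parity of that cell, and leaves a tiling of n + 1
-- cells. A domino on cells n + 1 and n + 2 contributes q to the power n + 1, and leaves a tiling of
-- n cells. The index of `F` is one more than the length of the board, so an even index goes with an
-- odd last cell, and the sums of weights satisfy exactly the recurrence of `F`. Boards of 0 and 1
-- cells are the base of the induction (`F-suc≈weights`). The combinatorics lies in `weight-square`
-- and `weight-domino`. The remaining work is to pull a common factor out of a finite sum
-- (`∑-map-*`), which needs coefficient lists modulo `_≈_` to form a commutative semiring.

-- Coefficients of sums and products.

coeff-+ : ∀ p r k → coeff (p + r) k ≡ coeff p k ℕ.+ coeff r k
coeff-+ []      r       k       = refl
coeff-+ (c ∷ p) []      k       = sym (ℕ.+-identityʳ _)
coeff-+ (c ∷ p) (d ∷ r) zero    = refl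
coeff-+ (c ∷ p) (d ∷ r) (suc k) = coeff-+ p r k

coeff-map-* : ∀ c p k → coeff (map (c ℕ.*_) p) k ≡ c ℕ.* coeff p k
coeff-map-* c []      k       = sym (ℕ.*-zeroʳ c)
coeff-map-* c (d ∷ p) zero    = refl
coeff-map-* c (d ∷ p) (suc k) = coeff-map-* c p k

coeff-∷-* : ∀ c p r k →
  coeff ((c ∷ p) * r) k ≡ c ℕ.* coeff r k ℕ.+ coeff (0 ∷ p * r) k
coeff-∷-* c p r k =
  trans (coeff-+ (map (c ℕ.*_) r) _ k) (cong (ℕ._+ _) (coeff-map-* c r k))

coeff-*-zero : ∀ p r → coeff (p * r) 0 ≡ coeff p 0 ℕ.* coeff r 0
coeff-*-zero []      r = refl
coeff-*-zero (c ∷ p) r = trans (coeff-∷-* c p r 0) (ℕ.+-identityʳ _)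

coeff-0# : ∀ k → coeff 0# k ≡ 0
coeff-0# zero    = refl
coeff-0# (suc k) = refl

-- Multiplication recurses on its left factor; this supplies the matching recursion on the right
-- factor, from which commutativity follows.
coeff-*-∷-suc : ∀ p d r k →
  coeff (p * (d ∷ r)) (suc k) ≡ d ℕ.* coeff p (suc k) ℕ.+ coeff (p * r) k
coeff-*-∷-suc [] d r k = sym (trans (ℕ.+-identityʳ _) (ℕ.*-zeroʳ d))
coeff-*-∷-suc (c ∷ p) d r zero = begin
  coeff ((c ∷ p) * (d ∷ r)) 1                   ≡⟨ coeff-∷-* c p (d ∷ r) 1 ⟩
  c ℕ.* coeff r 0 ℕ.+ coeff (p * (d ∷ r)) 0     ≡⟨ cong (_ ℕ.+_) (coeff-*-zero p (d ∷ r)) ⟩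
  c ℕ.* coeff r 0 ℕ.+ coeff p 0 ℕ.* d           ≡⟨ ℕ.+-comm (c ℕ.* coeff r 0) _ ⟩
  coeff p 0 ℕ.* d ℕ.+ c ℕ.* coeff r 0           ≡⟨ cong₂ ℕ._+_ (ℕ.*-comm (coeff p 0) d) (sym (coeff-*-zero (c ∷ p) r)) ⟩
  d ℕ.* coeff p 0 ℕ.+ coeff ((c ∷ p) * r) 0     ∎
  where open ≡-Reasoning
coeff-*-∷-suc (c ∷ p) d r (suc k) = begin
  coeff ((c ∷ p) * (d ∷ r)) (suc (suc k))
    ≡⟨ coeff-∷-* c p (d ∷ r) (suc (suc k)) ⟩
  c ℕ.* coeff r (suc k) ℕ.+ coeff (p * (d ∷ r)) (suc k)
    ≡⟨ cong (_ ℕ.+_) (coeff-*-∷-suc p d r k) ⟩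
  c ℕ.* coeff r (suc k) ℕ.+ (d ℕ.* coeff p (suc k) ℕ.+ coeff (p * r) k)
    ≡⟨ x∙yz≈y∙xz (c ℕ.* coeff r (suc k)) (d ℕ.* coeff p (suc k)) _ ⟩
  d ℕ.* coeff p (suc k) ℕ.+ (c ℕ.* coeff r (suc k) ℕ.+ coeff (p * r) k)
    ≡⟨ cong (_ ℕ.+_) (coeff-∷-* c p r (suc k)) ⟨
  d ℕ.* coeff p (suc k) ℕ.+ coeff ((c ∷ p) * r) (suc k) ∎
  where open ≡-Reasoning

-- The commutative semiring of polynomials.

+-cong : ∀ {p p′ r r′} → p ≈ p′ → r ≈ r′ → p + r ≈ p′ + r′
+-cong {p} {p′} {r} {r′} e f k =
  trans (coeff-+ p r k) (trans (cong₂ ℕ._+_ (e k) (f k)) (sym (coeff-+ p′ r′ k)))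

+-assoc : ∀ p r s → (p + r) + s ≈ p + (r + s)
+-assoc p r s k = begin
  coeff ((p + r) + s) k                        ≡⟨ coeff-+ (p + r) s k ⟩
  coeff (p + r) k ℕ.+ coeff s k                ≡⟨ cong (ℕ._+ _) (coeff-+ p r k) ⟩
  coeff p k ℕ.+ coeff r k ℕ.+ coeff s k        ≡⟨ ℕ.+-assoc (coeff p k) _ _ ⟩
  coeff p k ℕ.+ (coeff r k ℕ.+ coeff s k)      ≡⟨ cong (_ ℕ.+_) (coeff-+ r s k) ⟨
  coeff p k ℕ.+ coeff (r + s) k                ≡⟨ coeff-+ p (r + s) k ⟨
  coeff (p + (r + s)) k                        ∎
  where open ≡-Reasoning

+-comm : ∀ p r → p + r ≈ r + p
+-comm p r k = trans (coeff-+ p r k) (trans (ℕ.+-comm (coeff p k) _) (sym (coeff-+ r p k)))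

+-identityʳ : ∀ p → p + 0# ≈ p
+-identityʳ p k =
  trans (coeff-+ p 0# k) (trans (cong (coeff p k ℕ.+_) (coeff-0# k)) (ℕ.+-identityʳ _))

-- The zero polynomial has several representations: this treats the empty list, whereas `0#` is a
-- list with one zero entry.
*-zeroʳ-[] : ∀ p → p * [] ≈ []
*-zeroʳ-[] []      k       = refl
*-zeroʳ-[] (c ∷ p) zero    = refl
*-zeroʳ-[] (c ∷ p) (suc k) = *-zeroʳ-[] p k

*-comm : ∀ p r → p * r ≈ r * p
*-comm []      r k       = sym (*-zeroʳ-[] r k)
*-comm (c ∷ p) r zero    =
  trans (coeff-*-zero (c ∷ p) r)
    (trans (ℕ.*-comm c (coeff r 0)) (sym (coeff-*-zero r (c ∷ p))))
-- Splitting c off the left factor of one product and off the right factor of the other leaves the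
-- same first summand; the rest is the induction hypothesis.
*-comm (c ∷ p) r (suc k) =
  trans (coeff-∷-* c p r (suc k))
    (trans (cong (_ ℕ.+_) (*-comm p r k)) (sym (coeff-*-∷-suc r c p k)))

∷-congʳ : ∀ c {p r} → p ≈ r → c ∷ p ≈ c ∷ r
∷-congʳ c e zero    = refl
∷-congʳ c e (suc k) = e k

*-congˡ : ∀ p {r s} → r ≈ s → p * r ≈ p * s
*-congˡ []      e k = refl
*-congˡ (c ∷ p) {r} {s} e k =
  trans (coeff-∷-* c p r k)
    (trans (cong₂ ℕ._+_ (cong (c ℕ.*_) (e k)) (∷-congʳ 0 {p * r} (*-congˡ p e) k))
      (sym (coeff-∷-* c p s k)))

-- Equal polynomials may be lists of different lengths, so the left factor is not replaced by
-- recursion on it; commutativity moves it to the right, where `*-congˡ` applies.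
*-cong : ∀ {p p′ r r′} → p ≈ p′ → r ≈ r′ → p * r ≈ p′ * r′
*-cong {p} {p′} {r} {r′} e f k = begin
  coeff (p * r) k    ≡⟨ *-congˡ p {r} {r′} f k ⟩
  coeff (p * r′) k   ≡⟨ *-comm p r′ k ⟩
  coeff (r′ * p) k   ≡⟨ *-congˡ r′ {p} {p′} e k ⟩
  coeff (r′ * p′) k  ≡⟨ *-comm r′ p′ k ⟩
  coeff (p′ * r′) k  ∎
  where open ≡-Reasoning

*-distribˡ-+ : ∀ p r s → p * (r + s) ≈ p * r + p * s
*-distribˡ-+ []      r s k = refl
*-distribˡ-+ (c ∷ p) r s k = begin
  coeff ((c ∷ p) * (r + s)) k
    ≡⟨ coeff-∷-* c p (r + s) k ⟩
  c ℕ.* coeff (r + s) k ℕ.+ coeff (0 ∷ p * (r + s)) k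
    ≡⟨ cong₂ ℕ._+_ (trans (cong (c ℕ.*_) (coeff-+ r s k)) (ℕ.*-distribˡ-+ c (coeff r k) _))
                   (trans (∷-congʳ 0 {p * (r + s)} (*-distribˡ-+ p r s) k)
                          (coeff-+ (0 ∷ p * r) (0 ∷ p * s) k)) ⟩
  (c ℕ.* coeff r k ℕ.+ c ℕ.* coeff s k) ℕ.+ (coeff (0 ∷ p * r) k ℕ.+ coeff (0 ∷ p * s) k)
    ≡⟨ interchange (c ℕ.* coeff r k) (c ℕ.* coeff s k) (coeff (0 ∷ p * r) k) _ ⟩
  (c ℕ.* coeff r k ℕ.+ coeff (0 ∷ p * r) k) ℕ.+ (c ℕ.* coeff s k ℕ.+ coeff (0 ∷ p * s) k)
    ≡⟨ cong₂ ℕ._+_ (coeff-∷-* c p r k) (coeff-∷-* c p s k) ⟨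
  coeff ((c ∷ p) * r) k ℕ.+ coeff ((c ∷ p) * s) k
    ≡⟨ coeff-+ ((c ∷ p) * r) _ k ⟨
  coeff ((c ∷ p) * r + (c ∷ p) * s) k ∎
  where open ≡-Reasoning

*-distribʳ-+ : ∀ p r s → (r + s) * p ≈ r * p + s * p
*-distribʳ-+ p r s k =
  trans (*-comm (r + s) p k)
    (trans (*-distribˡ-+ p r s k)
      (+-cong {p * r} {r * p} {p * s} {s * p} (*-comm p r) (*-comm p s) k))

-- Associativity for a scalar as first factor: the contribution of the leading entry in `*-assoc`.
map-*-assoc : ∀ c p r → map (c ℕ.*_) p * r ≈ map (c ℕ.*_) (p * r)
map-*-assoc c []      r k = refl
map-*-assoc c (d ∷ p) r k = begin
  coeff ((c ℕ.* d ∷ map (c ℕ.*_) p) * r) k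
    ≡⟨ coeff-∷-* (c ℕ.* d) (map (c ℕ.*_) p) r k ⟩
  c ℕ.* d ℕ.* coeff r k ℕ.+ coeff (0 ∷ map (c ℕ.*_) p * r) k
    ≡⟨ cong₂ ℕ._+_ (ℕ.*-assoc c d _) (shift k) ⟩
  c ℕ.* (d ℕ.* coeff r k) ℕ.+ c ℕ.* coeff (0 ∷ p * r) k
    ≡⟨ ℕ.*-distribˡ-+ c (d ℕ.* coeff r k) _ ⟨
  c ℕ.* (d ℕ.* coeff r k ℕ.+ coeff (0 ∷ p * r) k)
    ≡⟨ cong (c ℕ.*_) (coeff-∷-* d p r k) ⟨
  c ℕ.* coeff ((d ∷ p) * r) k
    ≡⟨ coeff-map-* c ((d ∷ p) * r) k ⟨
  coeff (map (c ℕ.*_) ((d ∷ p) * r)) k ∎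
  where
  open ≡-Reasoning
  shift : ∀ k → coeff (0 ∷ map (c ℕ.*_) p * r) k ≡ c ℕ.* coeff (0 ∷ p * r) k
  shift zero    = sym (ℕ.*-zeroʳ c)
  shift (suc k) = trans (map-*-assoc c p r k) (coeff-map-* c (p * r) k)

*-assoc : ∀ p r s → (p * r) * s ≈ p * (r * s)
*-assoc []      r s k = refl
*-assoc (c ∷ p) r s k = begin
  coeff ((map (c ℕ.*_) r + (0 ∷ p * r)) * s) k
    ≡⟨ *-distribʳ-+ s (map (c ℕ.*_) r) (0 ∷ p * r) k ⟩
  coeff (map (c ℕ.*_) r * s + (0 ∷ p * r) * s) k
    ≡⟨ +-cong {map (c ℕ.*_) r * s} {map (c ℕ.*_) (r * s)} {(0 ∷ p * r) * s} {0 ∷ p * (r * s)}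
              (map-*-assoc c r s) shift k ⟩
  coeff (map (c ℕ.*_) (r * s) + (0 ∷ p * (r * s))) k ∎
  where
  open ≡-Reasoning
  shift : (0 ∷ p * r) * s ≈ 0 ∷ p * (r * s)
  shift j = trans (coeff-∷-* 0 (p * r) s j) (∷-congʳ 0 {(p * r) * s} (*-assoc p r s) j)

*-identityʳ : ∀ p → p * 1# ≈ p
*-identityʳ []      k       = refl
*-identityʳ (c ∷ p) zero    = trans (coeff-*-zero (c ∷ p) 1#) (ℕ.*-identityʳ c)
-- The tail of the product computes to `p * 1#`, since the scaled copy of `1#` has only a constant
-- term.
*-identityʳ (c ∷ p) (suc k) = *-identityʳ p k

*-zeroʳ : ∀ p → p * 0# ≈ 0#
*-zeroʳ p zero    = trans (coeff-*-zero p 0#) (ℕ.*-zeroʳ (coeff p 0))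
*-zeroʳ p (suc k) = trans (coeff-*-∷-suc p 0 [] k) (*-zeroʳ-[] p k)

≈-isEquivalence : IsEquivalence _≈_
≈-isEquivalence = record
  { refl  = λ k → refl
  ; sym   = λ e k → sym (e k)
  ; trans = λ e f k → trans (e k) (f k)
  }

ℕ[q]-commutativeSemiring : CommutativeSemiring 0ℓ 0ℓ
ℕ[q]-commutativeSemiring = record
  { Carrier = Poly
  ; _≈_ = _≈_
  ; _+_ = _+_
  ; _*_ = _*_
  ; 0#  = 0#
  ; 1#  = 1#
  ; isCommutativeSemiring = isCommutativeSemiringʳ record
    { +-isCommutativeMonoid = isCommutativeMonoidʳ record
      { isSemigroup = record
        { isMagma = record
          { isEquivalence = ≈-isEquivalence
          ; ∙-cong = λ {p} {p′} {r} {r′} → +-cong {p} {p′} {r} {r′}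
          }
        ; assoc = +-assoc
        }
      ; identityʳ = +-identityʳ
      ; comm = +-comm
      }
    ; *-isCommutativeMonoid = isCommutativeMonoidʳ record
      { isSemigroup = record
        { isMagma = record
          { isEquivalence = ≈-isEquivalence
          ; ∙-cong = λ {p} {p′} {r} {r′} → *-cong {p} {p′} {r} {r′}
          }
        ; assoc = *-assoc
        }
      ; identityʳ = *-identityʳ
      ; comm = *-comm
      }
    ; distribˡ = *-distribˡ-+
    ; zeroʳ = *-zeroʳ
    }
  }

-- Finite sums and products over an abstract commutative semiring.

-- The equality of Poly unfolds to its coefficients, from which Agda cannot infer
-- the polynomials; over an abstract semiring the implicit arguments are found.
module _ {c ℓ} (R : CommutativeSemiring c ℓ) where
  private
    module R = CommutativeSemiring R
    open SemiringExp R.semiring using (^-homo-*) renaming (_^_ to _^ᴿ_)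
    open CommutativeSemigroupProperties R.*-commutativeSemigroup
      using () renaming (x∙yz≈y∙xz to x*yz≈y*xz)

    ∑ : {A : Set} → List A → (A → R.Carrier) → R.Carrier
    ∑ xs f = foldr R._+_ R.0# (map f xs)

  ∑-++ : {A : Set} (f : A → R.Carrier) (xs ys : List A) →
    ∑ (xs ++ ys) f R.≈ ∑ xs f R.+ ∑ ys f
  ∑-++ f []       ys = R.sym (R.+-identityˡ _)
  ∑-++ f (x ∷ xs) ys = R.trans (R.+-congˡ (∑-++ f xs ys)) (R.sym (R.+-assoc _ _ _))

  ∑-map-* : {A B : Set} (f : B → R.Carrier) (g : A → B) (h : A → R.Carrier) (z : R.Carrier) →
    (∀ x → f (g x) R.≈ z R.* h x) → ∀ xs → ∑ (map g xs) f R.≈ z R.* ∑ xs h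
  ∑-map-* f g h z e []       = R.sym (R.zeroʳ z)
  ∑-map-* f g h z e (x ∷ xs) =
    R.trans (R.+-cong (e x) (∑-map-* f g h z e xs)) (R.sym (R.distribˡ z _ _))

  -- This and the next two lemmas bring one factor to the front of a weight, a product of powers of
  -- a, b and q: an a-square, a b-square, and a domino respectively.
  pull-first : ∀ x m y z → (x ^ᴿ suc m) R.* y R.* z R.≈ x R.* ((x ^ᴿ m) R.* y R.* z)
  pull-first x m y z = R.trans (R.*-congʳ (R.*-assoc _ _ _)) (R.*-assoc _ _ _)

  pull-second : ∀ x y m z → x R.* (y ^ᴿ suc m) R.* z R.≈ y R.* (x R.* (y ^ᴿ m) R.* z)
  pull-second x y m z = R.trans (R.*-congʳ (x*yz≈y*xz _ _ _)) (R.*-assoc _ _ _)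

  pull-third : ∀ x y z m n → x R.* y R.* (z ^ᴿ (m ℕ.+ n)) R.≈ (z ^ᴿ m) R.* (x R.* y R.* (z ^ᴿ n))
  pull-third x y z m n =
    R.trans (R.*-congˡ (^-homo-* z m n)) (x*yz≈y*xz _ _ _)

  +-*-cong : ∀ z w {f g x y s t} → f R.≈ x → g R.≈ y → s R.≈ z R.* x → t R.≈ w R.* y →
    z R.* f R.+ w R.* g R.≈ s R.+ t
  +-*-cong z w f≈x g≈y s≈zx t≈wy =
    R.+-cong (R.trans (R.*-congˡ f≈x) (R.sym s≈zx)) (R.trans (R.*-congˡ g≈y) (R.sym t≈wy))

  -- Serves the board with one cell: it admits no domino, and correspondingly the second term of the
  -- recurrence contains `F a b 0`, which is `0#`.
  +-*-0#-cong : ∀ z w {f x s} → f R.≈ x → s R.≈ z R.* x → z R.* f R.+ w R.* R.0# R.≈ s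
  +-*-0#-cong z w f≈x s≈zx =
    R.trans (+-*-cong z w f≈x R.refl s≈zx (R.sym (R.zeroʳ w))) (R.+-identityʳ _)

-- Weights of tilings and the recurrence.

module _ (a b : ℕ) where

  weight : ∀ {n} → Tiling n → Poly
  weight T = const a ^ ∣ T ∣a * const b ^ ∣ T ∣b * q ^ ∣ T ∣

  weight-square : ∀ {n} (T : Tiling n) →
    weight (T ▸square) ≈ const (byParity (parity n) a b) * weight T
  -- The new square lies on cell n + 1, whose parity is opposite to that of n. Writing `parity n` as
  -- that inverse lets one case split decide both the color factor and which square count grows.
  weight-square {n} T rewrite sym (suc-homo-⁻¹ n) with parity (suc n)
  ... | 1ℙ = pull-first ℕ[q]-commutativeSemiring (const a) ∣ T ∣a (const b ^ ∣ T ∣b) (q ^ ∣ T ∣)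
  ... | 0ℙ = pull-second ℕ[q]-commutativeSemiring (const a ^ ∣ T ∣a) (const b) ∣ T ∣b (q ^ ∣ T ∣)

  weight-domino : ∀ {n} (T : Tiling n) → weight (T ▸domino) ≈ q ^ suc n * weight T
  weight-domino {n} T =
    pull-third ℕ[q]-commutativeSemiring (const a ^ ∣ T ∣a) (const b ^ ∣ T ∣b) q (suc n) ∣ T ∣

  weights : ℕ → Poly
  weights n = ∑[ T ← 𝒯 n ] weight T

  F-suc≈weights : ∀ n → F a b (suc n) ≈ weights n
  -- The only tiling is `empty`; all its exponents are 0, so its weight computes to 1 whatever a and
  -- b are.
  F-suc≈weights zero zero          = refl
  F-suc≈weights zero (suc zero)    = refl
  F-suc≈weights zero (suc (suc k)) = refl
  F-suc≈weights (suc zero) =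
    +-*-0#-cong R (const a) (q ^ 0) {F a b 1} {weights 0} {weights 1}
      (F-suc≈weights 0)
      (∑-map-* R weight _▸square weight (const a) weight-square (𝒯 0))
    where R = ℕ[q]-commutativeSemiring
  F-suc≈weights (suc (suc n)) = R.trans
    {F a b (3 ℕ.+ n)} {squares + dominoes} {weights (2 ℕ.+ n)}
    (+-*-cong R z (q ^ suc n)
      {F a b (2 ℕ.+ n)} {F a b (suc n)} {weights (suc n)} {weights n} {squares} {dominoes}
      (F-suc≈weights (suc n))
      (F-suc≈weights n)
      (∑-map-* R weight _▸square weight z weight-square (𝒯 (suc n)))
      (∑-map-* R weight _▸domino weight (q ^ suc n) weight-domino (𝒯 n)))
    (R.sym {weights (2 ℕ.+ n)} {squares + dominoes}
      (∑-++ R weight (map _▸square (𝒯 (suc n))) (map _▸domino (𝒯 n))))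
    where
    R = ℕ[q]-commutativeSemiring
    module R = CommutativeSemiring R
    z squares dominoes : Poly
    -- `parity` discards two successors by computation, so this is both the coefficient in the
    -- recurrence for `F a b (3 ℕ.+ n)` and the factor of a square on cell n + 2.
    z        = const (byParity (parity (suc n)) a b)
    squares  = ∑[ T ← map _▸square (𝒯 (suc n)) ] weight T
    dominoes = ∑[ T ← map _▸domino (𝒯 n) ] weight T

theorem11 : (a b : ℕ) .{{_ : NonZero a}} .{{_ : NonZero b}} (n : ℕ) →
    F a b (suc n) ≈ (∑[ T ← 𝒯 n ] const a ^ ∣ T ∣a * const b ^ ∣ T ∣b * q ^ ∣ T ∣)
theorem11 a b n = F-suc≈weights a b n
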